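{- Let $\mathfrak A$ be an $L$-structure and $a,b,c,d\in A$. (1) Let $t(x,y)$ be a c-term. If $t^{\mathfrak A}(a,b)=t^{\mathfrak A}(c,d)$ and $t^{\mathfrak A}(a,b)\neq t^{\mathfrak A}(c,d')$ for all $d'\in A$ with $d'\neq d$, then $\mathfrak A\models a\to b:\cdot\, c\to d$. (2) Let $t_a,t_b,t_c,t_d$ be c-terms such that $t_a^{\mathfrak A}(a,b)=t_a^{\mathfrak A}(c,d)$ and $t_a^{\mathfrak A}(a',b)\neq t_a^{\mathfrak A}(c,d)$ for all $a'\neq a$; $t_b^{\mathfrak A}(a,b)=t_b^{\mathfrak A}(c,d)$ and $t_b^{\mathfrak A}(a,b')\neq t_b^{\mathfrak A}(c,d)$ for all $b'\neq b$; $t_c^{\mathfrak A}(a,b)=t_c^{\mathfrak A}(c,d)$ and $t_c^{\mathfrak A}(a,b)\neq t_c^{\mathfrak A}(c',d)$ for all $c'\neq c$; $t_d^{\mathfrak A}(a,b)=t_d^{\mathfrak A}(c,d)$ and $t_d^{\mathfrak A}(a,b)\neq t_d^{\mathfrak A}(c,d')$ for all $d'\neq d$. Then $\mathfrak A\models a:b::c:d$.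
   Context: A c-term is an $L$-term containing both variables $x$ and $y$ (and no others); $t^{\mathfrak A}$ is the induced term function. A c-formula is a conjunctive $L$-formula (built from atomic formulas using only $\wedge,\exists,\forall$) with free variables exactly $x,y$ whose dependency graph (vertices: its variables; edge $\{w,z\}$ iff $w,z$ occur together in an atomic subformula) is connected; elements of $A$ may be used as parameters (e.g. the formula $t(x,y)=t^{\mathfrak A}(a,b)$ counts as a c-formula). $\uparrow_{\mathfrak A}(a\to b)=\{\alpha\text{ c-formula}:\mathfrak A\models\alpha(a,b)\}$; $\uparrow_{\mathfrak A}(a\to b:\cdot\, c\to d)=\uparrow_{\mathfrak A}(a\to b)\cap\uparrow_{\mathfrak A}(c\to d)$. A c-formula is trivial in $\mathfrak A$ iff it lies in $\uparrow_{\mathfrak A}(a\to b:\cdot\, c\to d)$ for all $a,b,c,d\in A$; $\emptyset_{\mathfrak A}$ is the set of these. $\mathfrak A\models a\to b:\cdot\, c\to d$ iff either $\uparrow_{\mathfrak A}(a\to b)\cup\uparrow_{\mathfrak A}(c\to d)$ consists only of trivial formulas, or $\uparrow_{\mathfrak A}(a\to b:\cdot\, c\to d)$ contains a non-trivial formula and for every $d'\in A$, $\emptyset_{\mathfrak A}\subsetneq\uparrow(a\to b:\cdot\, c\to d)\subseteq\uparrow(a\to b:\cdot\, c\to d')$ implies $\emptyset_{\mathfrak A}\subsetneq\uparrow(a\to b:\cdot\, c\to d')\subseteq\uparrow(a\to b:\cdot\, c\to d)$. $\mathfrak A\models a:b::c:d$ iff $\mathfrak A\models a\to b:\cdot\,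 c\to d$, $b\to a:\cdot\, d\to c$, $c\to d:\cdot\, a\to b$ and $d\to c:\cdot\, b\to a$. -}

module Defs where

open import Data.Bool.Base using (if_then_else_)
open import Data.Nat.Base using (ℕ; zero; suc; _≡ᵇ_)
open import Data.Product.Base using (_×_; ∃-syntax)
open import Data.Sum.Base using (_⊎_; inj₁; inj₂; [_,_])
open import Data.Vec.Base using (Vec; []; _∷_)
open import Level using (Level; Lift; 0ℓ; _⊔_) renaming (suc to ℓ-suc)
open import Relation.Binary.Construct.Closure.ReflexiveTransitive using (Star)
open import Relation.Binary.Core using (Rel)
open import Relation.Binary.PropositionalEquality.Core using (_≡_)
open import Relation.Unary using (Pred; _∈_; _∉_; _⊆_; _⊂_; _≐_; _∪_; _∩_; _∖_; ∅; ｛_｝)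

private
  variable
    f r a s : Level

-- One-sorted first-order languages; constants are function symbols of arity 0.

record Language (f r : Level) : Set (ℓ-suc (f ⊔ r)) where
  field
    FunSym   : Set f
    funArity : FunSym → ℕ
    RelSym   : Set r
    relArity : RelSym → ℕ

record Structure (L : Language f r) (a s : Level) : Set (f ⊔ r ⊔ ℓ-suc (a ⊔ s)) where
  open Language L
  field
    Carrier : Set a
    fun     : (g : FunSym) → Vec Carrier (funArity g) → Carrier
    rel     : (R : RelSym) → Pred (Vec Carrier (relArity R)) s

open Structure public using (Carrier)

-- Variables are named, because the dependency graph of a formula has the
-- variable names as its vertices: two quantifiers binding the same name share
-- a vertex.

Var : Set
Var = ℕ

x y : Var
x = 0
y = 1

module _ (L : Language f r) where
  open Language L

  data Term : Set f where
    var : Var → Term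
    app : (g : FunSym) → Vec Term (funArity g) → Term

  data Atomic : Set (f ⊔ r) where
    _≈_ : Term → Term → Atomic
    rel : (R : RelSym) → Vec Term (relArity R) → Atomic

  data ConjunctiveFormula : Set (f ⊔ r) where
    atom  : Atomic → ConjunctiveFormula
    _∧_   : ConjunctiveFormula → ConjunctiveFormula → ConjunctiveFormula
    ∃′ ∀′ : Var → ConjunctiveFormula → ConjunctiveFormula

module _ {L : Language f r} where

  mutual
    termVars : Term L → Pred Var 0ℓ
    termVars (var w)    = ｛ w ｝
    termVars (app _ ts) = termsVars ts

    termsVars : ∀ {n} → Vec (Term L) n → Pred Var 0ℓ
    termsVars []       = ∅
    termsVars (t ∷ ts) = termVars t ∪ termsVars ts

  atomicVars : Atomic L → Pred Var 0ℓ
  atomicVars (t ≈ u)    = termVars t ∪ termVars u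
  atomicVars (rel _ ts) = termsVars ts

  -- All variables of a formula: free, bound, or merely quantified over.

  vars : ConjunctiveFormula L → Pred Var 0ℓ
  vars (atom α) = atomicVars α
  vars (φ ∧ ψ)  = vars φ ∪ vars ψ
  vars (∃′ z φ) = ｛ z ｝ ∪ vars φ
  vars (∀′ z φ) = ｛ z ｝ ∪ vars φ

  freeVars : ConjunctiveFormula L → Pred Var 0ℓ
  freeVars (atom α) = atomicVars α
  freeVars (φ ∧ ψ)  = freeVars φ ∪ freeVars ψ
  freeVars (∃′ z φ) = freeVars φ ∖ ｛ z ｝
  freeVars (∀′ z φ) = freeVars φ ∖ ｛ z ｝

  -- The edge relation of the dependency graph. It contains loops, which do
  -- not affect connectedness.

  Edge : ConjunctiveFormula L → Rel Var 0ℓ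
  Edge (atom α) w z = w ∈ atomicVars α × z ∈ atomicVars α
  Edge (φ ∧ ψ)  w z = Edge φ w z ⊎ Edge ψ w z
  Edge (∃′ _ φ) w z = Edge φ w z
  Edge (∀′ _ φ) w z = Edge φ w z

  Connected : ConjunctiveFormula L → Set
  Connected φ = ∀ {w z} → w ∈ vars φ → z ∈ vars φ → Star (Edge φ) w z

module _ {L : Language f r} (𝔄 : Structure L a s) where
  private
    A = Carrier 𝔄
    module 𝔄 = Structure 𝔄

  Assignment : Set a
  Assignment = Var → A

  _[_↦_] : Assignment → Var → A → Assignment
  (ρ [ z ↦ e ]) w = if w ≡ᵇ z then e else ρ w

  mutual
    eval : Assignment → Term L → A
    eval ρ (var w)    = ρ w
    eval ρ (app g ts) = 𝔄.fun g (evals ρ ts)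

    evals : ∀ {n} → Assignment → Vec (Term L) n → Vec A n
    evals ρ []       = []
    evals ρ (t ∷ ts) = eval ρ t ∷ evals ρ ts

  SatAtomic : Assignment → Atomic L → Set (a ⊔ s)
  SatAtomic ρ (t ≈ u)    = Lift s (eval ρ t ≡ eval ρ u)
  SatAtomic ρ (rel R ts) = Lift a (𝔄.rel R (evals ρ ts))

  Sat : Assignment → ConjunctiveFormula L → Set (a ⊔ s)
  Sat ρ (atom α) = SatAtomic ρ α
  Sat ρ (φ ∧ ψ)  = Sat ρ φ × Sat ρ ψ
  Sat ρ (∃′ z φ) = ∃[ e ] Sat (ρ [ z ↦ e ]) φ
  Sat ρ (∀′ z φ) = ∀ e → Sat (ρ [ z ↦ e ]) φ

  -- The assignment x ↦ p, y ↦ q. It is applied only to terms and formulas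
  -- with no other free variables, so the values elsewhere are immaterial.

  xy↦ : A → A → Assignment
  xy↦ p q zero    = p
  xy↦ p q (suc _) = q

-- L(A): the language L with a new constant for every element of A, which is
-- how formulas use elements of A as parameters.

_⟨_⟩ : Language f r → Set a → Language (f ⊔ a) r
L ⟨ A ⟩ = record
  { FunSym   = FunSym ⊎ A
  ; funArity = [ funArity , (λ _ → 0) ]
  ; RelSym   = RelSym
  ; relArity = relArity
  } where open Language L

expand : {L : Language f r} (𝔄 : Structure L a s) → Structure (L ⟨ Carrier 𝔄 ⟩) a s
expand 𝔄 = record
  { Carrier = Carrier 𝔄
  ; fun     = λ { (inj₁ g) → Structure.fun 𝔄 g ; (inj₂ e) _ → e }
  ; rel     = Structure.rel 𝔄
  }

record CTerm (L : Language f r) : Set f where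
  field
    term   : Term L
    isXY   : termVars term ≐ ｛ x ｝ ∪ ｛ y ｝

termFunction : {L : Language f r} (𝔄 : Structure L a s) →
               CTerm L → Carrier 𝔄 → Carrier 𝔄 → Carrier 𝔄
termFunction 𝔄 t p q = eval 𝔄 (xy↦ 𝔄 p q) (CTerm.term t)

record CFormula {L : Language f r} (𝔄 : Structure L a s) : Set (f ⊔ r ⊔ a) where
  field
    formula   : ConjunctiveFormula (L ⟨ Carrier 𝔄 ⟩)
    isXY      : freeVars formula ≐ ｛ x ｝ ∪ ｛ y ｝
    connected : Connected formula

module Justification {L : Language f r} (𝔄 : Structure L a s) where
  private
    A = Carrier 𝔄

  ↑[_⟶_] : A → A → Pred (CFormula 𝔄) (a ⊔ s)
  ↑[ p ⟶ q ] α = Sat (expand 𝔄) (xy↦ (expand 𝔄) p q) (CFormula.formula α)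

  ↑[_⟶_:·_⟶_] : A → A → A → A → Pred (CFormula 𝔄) (a ⊔ s)
  ↑[ p ⟶ q :· u ⟶ v ] = ↑[ p ⟶ q ] ∩ ↑[ u ⟶ v ]

  Trivial : Pred (CFormula 𝔄) (a ⊔ s)
  Trivial α = ∀ p q u v → α ∈ ↑[ p ⟶ q :· u ⟶ v ]

infix 4 _⊨_⟶_:·_⟶_ _⊨_∶_∷_∶_

_⊨_⟶_:·_⟶_ : {L : Language f r} (𝔄 : Structure L a s) →
             (p q u v : Carrier 𝔄) → Set (f ⊔ r ⊔ a ⊔ s)
𝔄 ⊨ p ⟶ q :· u ⟶ v =
  (↑[ p ⟶ q ] ∪ ↑[ u ⟶ v ] ⊆ Trivial)
  ⊎
  ((∃[ α ] (α ∈ ↑[ p ⟶ q :· u ⟶ v ] × α ∉ Trivial))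
   × (∀ v′ →
        Trivial ⊂ ↑[ p ⟶ q :· u ⟶ v ]
        × ↑[ p ⟶ q :· u ⟶ v ] ⊆ ↑[ p ⟶ q :· u ⟶ v′ ] →
        Trivial ⊂ ↑[ p ⟶ q :· u ⟶ v′ ]
        × ↑[ p ⟶ q :· u ⟶ v′ ] ⊆ ↑[ p ⟶ q :· u ⟶ v ]))
  where open Justification 𝔄

-- ∶ is the Unicode ratio sign, since a bare colon is reserved.

_⊨_∶_∷_∶_ : {L : Language f r} (𝔄 : Structure L a s) →
            (p q u v : Carrier 𝔄) → Set (f ⊔ r ⊔ a ⊔ s)
𝔄 ⊨ p ∶ q ∷ u ∶ v =
    (𝔄 ⊨ p ⟶ q :· u ⟶ v)
  × (𝔄 ⊨ q ⟶ p :· v ⟶ u)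
  × (𝔄 ⊨ u ⟶ v :· p ⟶ q)
  × (𝔄 ⊨ v ⟶ u :· q ⟶ p)

{-# OPTIONS --safe #-}

-- If t(x,y) = e, where e = t(a,b) = t(c,d) is used as a parameter, determines d
-- once a, b, c are given, then a justification of c → d′ by this c-formula
-- forces d′ = d. The formula is non-trivial as soon as some d′ ≠ d exists;
-- otherwise A is a singleton, where every satisfied formula is trivial.
-- The four conditions of part (2) reduce to part (1), two of them after
-- interchanging x and y in the term.

module Submission where

open import Defs
open import Axiom.ExcludedMiddle using (ExcludedMiddle)
open import Data.Nat.Base using (ℕ; zero; suc)
open import Data.Product.Base using (_×_; _,_; proj₁; proj₂; ∃-syntax)
open import Data.Sum.Base as Sum using (inj₁; inj₂; [_,_])
open import Data.Vec.Base using (Vec; []; _∷_)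
open import Function.Base using (id; _∘_)
open import Level using (Level; lift)
open import Relation.Binary.Construct.Closure.ReflexiveTransitive using (ε; _◅_)
open import Relation.Binary.PropositionalEquality
  using (_≡_; _≢_; _≗_; refl; sym; ≢-sym; trans; cong; cong₂; subst; subst₂)
open import Relation.Nullary.Decidable.Core using (yes; no; decidable-stable)
open import Relation.Unary using (_∈_; _∉_; _⊆_; _⊂_; _≐_; _∪_; ∅; ｛_｝)

private
  variable
    f r a s : Level
    n : ℕ

module _ {L : Language f r} (σ : Var → Var) where

  mutual
    rename : Term L → Term L
    rename (var w)    = var (σ w)
    rename (app g ts) = app g (renames ts)

    renames : Vec (Term L) n → Vec (Term L) n
    renames []       = []
    renames (t ∷ ts) = rename t ∷ renames ts

  mutual
    ∈-rename⁺ : ∀ t {w} → w ∈ termVars t → σ w ∈ termVars (rename t)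
    ∈-rename⁺ (var _)    refl = refl
    ∈-rename⁺ (app _ ts)      = ∈-renames⁺ ts

    ∈-renames⁺ : ∀ (ts : Vec _ n) {w} → w ∈ termsVars ts → σ w ∈ termsVars (renames ts)
    ∈-renames⁺ (t ∷ ts) = Sum.map (∈-rename⁺ t) (∈-renames⁺ ts)

  mutual
    -- Since `σ` need not be injective, all that can be recovered is some preimage of the variable.
    -- Together with `∈-rename⁺` this determines the variables of `swap t`.
    ∈-rename⁻ : ∀ t {w} → w ∈ termVars (rename t) → ∃[ v ] (v ∈ termVars t × σ v ≡ w)
    ∈-rename⁻ (var v)    σv≡w = v , refl , σv≡w
    ∈-rename⁻ (app _ ts)      = ∈-renames⁻ ts

    ∈-renames⁻ : ∀ (ts : Vec _ n) {w} → w ∈ termsVars (renames ts) →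
                 ∃[ v ] (v ∈ termsVars ts × σ v ≡ w)
    ∈-renames⁻ (t ∷ ts) (inj₁ w∈t)  with v , v∈t , eq ← ∈-rename⁻ t w∈t = v , inj₁ v∈t , eq
    ∈-renames⁻ (t ∷ ts) (inj₂ w∈ts) with v , v∈ts , eq ← ∈-renames⁻ ts w∈ts = v , inj₂ v∈ts , eq

  module _ (𝔄 : Structure L a s) {ρ ρ′ : Assignment 𝔄} (ρ∘σ≗ρ′ : ρ ∘ σ ≗ ρ′) where

    mutual
      eval-rename : ∀ t → eval 𝔄 ρ (rename t) ≡ eval 𝔄 ρ′ t
      eval-rename (var w)    = ρ∘σ≗ρ′ w
      eval-rename (app g ts) = cong (Structure.fun 𝔄 g) (evals-renames ts)

      evals-renames : ∀ (ts : Vec _ n) → evals 𝔄 ρ (renames ts) ≡ evals 𝔄 ρ′ ts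
      evals-renames []       = refl
      evals-renames (t ∷ ts) = cong₂ _∷_ (eval-rename t) (evals-renames ts)

-- Sending every nonzero variable to `x` matches `xy↦`, which gives all of them its second value. So
-- `xy↦ p q ∘ swapXY` agrees with `xy↦ q p` everywhere, not only at `x` and `y`.
swapXY : Var → Var
swapXY zero    = y
swapXY (suc _) = x

swap : {L : Language f r} → CTerm L → CTerm L
swap t = record
  { term = rename swapXY term
  -- The injections cross over: `x` occurs as the image of `y`, and `y` as the image of `x`.
  ; isXY = to , [ (λ { refl → ∈-rename⁺ swapXY term (proj₂ isXY (inj₂ refl)) })
                , (λ { refl → ∈-rename⁺ swapXY term (proj₂ isXY (inj₁ refl)) }) ]
  }
  where
  open CTerm t
  to : termVars (rename swapXY term) ⊆ ｛ x ｝ ∪ ｛ y ｝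
  to w∈ with ∈-rename⁻ swapXY term w∈
  ... | zero  , _ , refl = inj₂ refl
  ... | suc _ , _ , refl = inj₁ refl

termFunction-swap : {L : Language f r} (𝔄 : Structure L a s) (t : CTerm L) →
                    ∀ p q → termFunction 𝔄 (swap t) p q ≡ termFunction 𝔄 t q p
termFunction-swap 𝔄 t p q =
  eval-rename swapXY 𝔄 (λ { zero → refl ; (suc _) → refl }) (CTerm.term t)

module _ {L : Language f r} {A : Set a} where

  mutual
    embed : Term L → Term (L ⟨ A ⟩)
    embed (var w)    = var w
    embed (app g ts) = app (inj₁ g) (embeds ts)

    embeds : Vec (Term L) n → Vec (Term (L ⟨ A ⟩)) n
    embeds []       = []
    embeds (t ∷ ts) = embed t ∷ embeds ts

  mutual
    -- Both predicates are built by the same unions from the same singletons, so they are equal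
    -- outright and not merely `≐`. This lets `termEquation` transport `isXY` by `subst`.
    termVars-embed : ∀ t → termVars (embed t) ≡ termVars t
    termVars-embed (var _)    = refl
    termVars-embed (app _ ts) = termsVars-embeds ts

    termsVars-embeds : ∀ (ts : Vec _ n) → termsVars (embeds ts) ≡ termsVars ts
    termsVars-embeds []       = refl
    termsVars-embeds (t ∷ ts) = cong₂ _∪_ (termVars-embed t) (termsVars-embeds ts)

module _ {L : Language f r} (𝔄 : Structure L a s) {ρ : Assignment (expand 𝔄)} {ρ′ : Assignment 𝔄}
         (ρ≗ρ′ : ρ ≗ ρ′) where

  mutual
    eval-embed : ∀ t → eval (expand 𝔄) ρ (embed t) ≡ eval 𝔄 ρ′ t
    eval-embed (var w)    = ρ≗ρ′ w
    eval-embed (app g ts) = cong (Structure.fun 𝔄 g) (evals-embeds ts)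

    evals-embeds : ∀ (ts : Vec _ n) → evals (expand 𝔄) ρ (embeds ts) ≡ evals 𝔄 ρ′ ts
    evals-embeds []       = refl
    evals-embeds (t ∷ ts) = cong₂ _∷_ (eval-embed t) (evals-embeds ts)

module _ {L : Language f r} (𝔄 : Structure L a s) where
  open Justification 𝔄

  termEquation : CTerm L → Carrier 𝔄 → CFormula 𝔄
  termEquation t e = record
    { formula   = atom (embed term ≈ app (inj₂ e) [])
    -- The summand `∅` comes from the right-hand side, a constant naming `e`.
    ; isXY      = subst (λ P → P ∪ ∅ ≐ ｛ x ｝ ∪ ｛ y ｝) (sym (termVars-embed term))
                        ([ proj₁ isXY , (λ ()) ] , inj₁ ∘ proj₂ isXY)
    -- With a single atom, any two variables share it, so a path of length one suffices.
    ; connected = λ w∈ z∈ → (w∈ , z∈) ◅ ε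
    }
    where open CTerm t

  module _ (t : CTerm L) {e p q : Carrier 𝔄} where
    private
      eval-term : eval (expand 𝔄) (xy↦ (expand 𝔄) p q) (embed (CTerm.term t)) ≡ termFunction 𝔄 t p q
      eval-term = eval-embed 𝔄 (λ { zero → refl ; (suc _) → refl }) (CTerm.term t)

    termEquation⁺ : termFunction 𝔄 t p q ≡ e → termEquation t e ∈ ↑[ p ⟶ q ]
    termEquation⁺ eq = lift (trans eval-term eq)

    termEquation⁻ : termEquation t e ∈ ↑[ p ⟶ q ] → termFunction 𝔄 t p q ≡ e
    termEquation⁻ (lift eq) = trans (sym eval-term) eq

  -- All pairs coincide, so satisfaction at one pair transports to every other.
  allEqual⇒Trivial : (∀ p q → p ≡ q) → ∀ α {p q} → α ∈ ↑[ p ⟶ q ] → α ∈ Trivial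
  allEqual⇒Trivial allEqual α {p} {q} α∈ p′ q′ u v = move p′ q′ , move u v
    where
    move : ∀ u v → α ∈ ↑[ u ⟶ v ]
    move u v = subst₂ (λ u v → α ∈ ↑[ u ⟶ v ]) (allEqual p u) (allEqual q v) α∈

  uniqueSolution⇒⟶ : ExcludedMiddle a → (t : CTerm L) {p q u v : Carrier 𝔄} →
    termFunction 𝔄 t p q ≡ termFunction 𝔄 t u v →
    (∀ v′ → v′ ≢ v → termFunction 𝔄 t p q ≢ termFunction 𝔄 t u v′) →
    𝔄 ⊨ p ⟶ q :· u ⟶ v
  uniqueSolution⇒⟶ em t {p} {q} {u} {v} eq unique with em {∃[ v′ ] v′ ≢ v}
  ... | no ∄v′ = inj₁ λ {α} → [ allEqual⇒Trivial allEqual α , allEqual⇒Trivial allEqual α ]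
    where
    ≡v : ∀ w → w ≡ v
    -- Excluded middle makes equality stable, so the absence of an element different from `v` forces
    -- `w ≡ v`.
    ≡v w = decidable-stable em (λ w≢v → ∄v′ (w , w≢v))

    allEqual : ∀ w z → w ≡ z
    allEqual w z = trans (≡v w) (sym (≡v z))
  ... | yes (v′ , v′≢v) = inj₂ ((α , α∈ , α∉Trivial) , maximal)
    where
    α : CFormula 𝔄
    -- With this parameter `α` holds at `(p, q)` by `refl`, and at `(u, w)` only if `t` takes the
    -- same value there as at `(p, q)`.
    α = termEquation t (termFunction 𝔄 t p q)

    α∈ : α ∈ ↑[ p ⟶ q :· u ⟶ v ]
    α∈ = termEquation⁺ t refl , termEquation⁺ t (sym eq)

    solution≡v : ∀ w → α ∈ ↑[ u ⟶ w ] → w ≡ v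
    solution≡v w α∈w =
      decidable-stable em (λ w≢v → unique w w≢v (sym (termEquation⁻ t α∈w)))

    α∉Trivial : α ∉ Trivial
    -- A trivial `α` would also hold at `(u, v′)`, making `v′` a second solution.
    α∉Trivial α∈T = v′≢v (solution≡v v′ (proj₂ (α∈T p q u v′)))

    maximal : ∀ w →
      Trivial ⊂ ↑[ p ⟶ q :· u ⟶ v ] × ↑[ p ⟶ q :· u ⟶ v ] ⊆ ↑[ p ⟶ q :· u ⟶ w ] →
      Trivial ⊂ ↑[ p ⟶ q :· u ⟶ w ] × ↑[ p ⟶ q :· u ⟶ w ] ⊆ ↑[ p ⟶ q :· u ⟶ v ]
    -- The inclusion carries `α` to `(u, w)`, hence `w` is `v` and both claims are about the same
    -- set.
    maximal w (T⊂ , ↑v⊆↑w) with refl ← solution≡v w (proj₂ (↑v⊆↑w {α} α∈)) = T⊂ , id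

  -- At reversed arguments `swap t` has the values of `t`, so uniqueness in the first argument
  -- becomes uniqueness in the second.
  uniqueSolution⇒⟵ : ExcludedMiddle a → (t : CTerm L) {p q u v : Carrier 𝔄} →
    termFunction 𝔄 t p q ≡ termFunction 𝔄 t u v →
    (∀ u′ → u′ ≢ u → termFunction 𝔄 t p q ≢ termFunction 𝔄 t u′ v) →
    𝔄 ⊨ q ⟶ p :· v ⟶ u
  uniqueSolution⇒⟵ em t {p} {q} {u} {v} eq unique = uniqueSolution⇒⟶ em (swap t)
    (subst₂ _≡_ (swapped p q) (swapped u v) eq)
    (λ u′ u′≢u → subst₂ _≢_ (swapped p q) (swapped u′ v) (unique u′ u′≢u))
    where
    swapped : ∀ p q → termFunction 𝔄 t p q ≡ termFunction 𝔄 (swap t) q p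
    swapped p q = sym (termFunction-swap 𝔄 t q p)

theorem10 : ∀ {f r ℓ s : Level} → ExcludedMiddle ℓ →
    (L : Language f r) (𝔄 : Structure L ℓ s) (a b c d : Carrier 𝔄) →
    (∀ (t : CTerm L) →
    termFunction 𝔄 t a b ≡ termFunction 𝔄 t c d →
    (∀ d′ → d′ ≢ d → termFunction 𝔄 t a b ≢ termFunction 𝔄 t c d′) →
    𝔄 ⊨ a ⟶ b :· c ⟶ d)
    ×
    (∀ (tᵃ tᵇ tᶜ tᵈ : CTerm L) →
    termFunction 𝔄 tᵃ a b ≡ termFunction 𝔄 tᵃ c d →
    (∀ a′ → a′ ≢ a → termFunction 𝔄 tᵃ a′ b ≢ termFunction 𝔄 tᵃ c d) →
    termFunction 𝔄 tᵇ a b ≡ termFunction 𝔄 tᵇ c d →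
    (∀ b′ → b′ ≢ b → termFunction 𝔄 tᵇ a b′ ≢ termFunction 𝔄 tᵇ c d) →
    termFunction 𝔄 tᶜ a b ≡ termFunction 𝔄 tᶜ c d →
    (∀ c′ → c′ ≢ c → termFunction 𝔄 tᶜ a b ≢ termFunction 𝔄 tᶜ c′ d) →
    termFunction 𝔄 tᵈ a b ≡ termFunction 𝔄 tᵈ c d →
    (∀ d′ → d′ ≢ d → termFunction 𝔄 tᵈ a b ≢ termFunction 𝔄 tᵈ c d′) →
    𝔄 ⊨ a ∶ b ∷ c ∶ d)
theorem10 em L 𝔄 a b c d =
    (λ t → uniqueSolution⇒⟶ 𝔄 em t)
  , λ tᵃ tᵇ tᶜ tᵈ eqᵃ uniqueᵃ eqᵇ uniqueᵇ eqᶜ uniqueᶜ eqᵈ uniqueᵈ →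
        uniqueSolution⇒⟶ 𝔄 em tᵈ eqᵈ uniqueᵈ
      , uniqueSolution⇒⟵ 𝔄 em tᶜ eqᶜ uniqueᶜ
      -- From here the pairs `(a, b)` and `(c, d)` exchange roles, so equations and inequalities are
      -- reversed.
      , uniqueSolution⇒⟶ 𝔄 em tᵇ (sym eqᵇ) (λ b′ b′≢b → ≢-sym (uniqueᵇ b′ b′≢b))
      , uniqueSolution⇒⟵ 𝔄 em tᵃ (sym eqᵃ) (λ a′ a′≢a → ≢-sym (uniqueᵃ a′ a′≢a))
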